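{- Let $n\geq p\geq 1$ and $k\geq 2$ be integers. Let $u$ be a length-$p$ word over $\Sigma_k$, let $b[1..p]$ be the border indicator of $u$ and let $a[1..p]$ be the unbordered prefix indicator of $u$. Then \[B_k(u,n) = \begin{cases} \sum\limits_{i=1}^{n-p}a[i]k^{n-p-i} + \sum\limits_{i=n-p+1}^{\lfloor n/2\rfloor} a[i]\,b[i-(n-p)], & \text{if } n \leq 2p;\\[2mm] \sum\limits_{i=1}^p a[i] k^{n-p-i} + \sum\limits_{i=p+1}^{\lfloor n/2\rfloor} \bigl(k^{i-p} - B_k(u,i)\bigr)k^{n-2i}, & \text{otherwise.} \end{cases}\]
   Context: $\Sigma_k=\{1,2,\ldots,k\}$. A border of a word $w$ is a word that is both a non-empty proper prefix and a non-empty proper suffix of $w$; $w$ is bordered if it has a border and unbordered otherwise. For a word $u$ and integer $m\ge |u|$, $B_k(u,m)$ denotes the number of length-$m$ bordered words over $\Sigma_k$ having $u$ as a prefix. For a word $u=u_1\cdots u_p$: its unbordered prefix indicator is the array $a[1..p]$ with $a[i]=1$ if $u_1\cdots u_i$ is unbordered and $a[i]=0$ otherwise; its border indicator is the array $b[1..p]$ with $b[i]=1$ if $u$ has a border of length $i$ and $b[i]=0$ otherwise. -}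

module Defs where

open import Data.Bool.Base using (if_then_else_)
open import Data.Fin.Base using (Fin)
import Data.Fin.Properties as Fin
open import Data.Integer.Base as ℤ using (ℤ)
open import Data.List.Base using (List; []; _∷_; length; map; filter; foldr; take; upTo; allFin; cartesianProductWith)
open import Data.List.Membership.Propositional using (_∈_)
open import Data.List.Membership.Propositional.Properties using (∈-allFin; ∈-cartesianProductWith⁺; ∈-cartesianProductWith⁻)
open import Data.List.Properties using (≡-dec; ∷-injective)
open import Data.List.Relation.Binary.Prefix.Heterogeneous using (Prefix; []; _∷_)
import Data.List.Relation.Binary.Prefix.Heterogeneous.Properties as Prefix
open import Data.List.Relation.Binary.Suffix.Heterogeneous using (Suffix)
import Data.List.Relation.Binary.Suffix.Heterogeneous.Properties as Suffix
import Data.List.Relation.Unary.All as All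
open import Data.List.Relation.Unary.AllPairs using ([]; _∷_)
open import Data.List.Relation.Unary.Any using (here)
open import Data.List.Relation.Unary.Unique.Propositional using (Unique)
import Data.List.Relation.Unary.Unique.Propositional.Properties as Unique
open import Data.Nat.Base using (ℕ; zero; suc; _+_; _∸_; s≤s)
open import Data.Nat.ListAction using (sum)
import Data.Nat.Properties as ℕ
open import Data.Product.Base using (∃; _×_; _,_)
open import Relation.Binary.Definitions using (DecidableEquality)
open import Relation.Binary.PropositionalEquality using (_≡_; _≢_; refl; sym; cong; cong₂; subst)
open import Relation.Nullary.Decidable using (Dec; does; map′; ¬?; _×-dec_)
open import Relation.Nullary.Negation using (¬_)

-- The alphabet Σₖ = {1,…,k} is represented by Fin k.
Word : ℕ → Set
Word k = List (Fin k)

_≟ʷ_ : ∀ {k} → DecidableEquality (Word k)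
_≟ʷ_ = ≡-dec Fin._≟_

IsPrefix : ∀ {k} → Word k → Word k → Set
IsPrefix = Prefix _≡_

IsSuffix : ∀ {k} → Word k → Word k → Set
IsSuffix = Suffix _≡_

isPrefix? : ∀ {k} (v w : Word k) → Dec (IsPrefix v w)
isPrefix? = Prefix.prefix? Fin._≟_

isSuffix? : ∀ {k} (v w : Word k) → Dec (IsSuffix v w)
isSuffix? = Suffix.suffix? Fin._≟_

record IsBorder {k : ℕ} (v w : Word k) : Set where
  constructor mkBorder
  field
    nonEmpty : v ≢ []
    proper   : v ≢ w
    prefix   : IsPrefix v w
    suffix   : IsSuffix v w

Bordered : ∀ {k} → Word k → Set
Bordered w = ∃ λ v → IsBorder v w

Unbordered : ∀ {k} → Word k → Set
Unbordered w = ¬ Bordered w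

HasBorderOfLength : ∀ {k} → Word k → ℕ → Set
HasBorderOfLength w i = ∃ λ v → IsBorder v w × length v ≡ i

isBorder? : ∀ {k} (v w : Word k) → Dec (IsBorder v w)
isBorder? v w = map′
  (λ (ne , pr , p , s) → mkBorder ne pr p s)
  (λ (mkBorder ne pr p s) → ne , pr , p , s)
  (¬? (v ≟ʷ []) ×-dec ¬? (v ≟ʷ w) ×-dec isPrefix? v w ×-dec isSuffix? v w)

prefix⇒take : ∀ {k} {v w : Word k} → IsPrefix v w → v ≡ take (length v) w
prefix⇒take []       = refl
prefix⇒take (e ∷ es) = cong₂ _∷_ e (prefix⇒take es)

-- The only candidate for a border of length i is the prefix of length i.
hasBorderOfLength? : ∀ {k} (w : Word k) (i : ℕ) → Dec (HasBorderOfLength w i)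
hasBorderOfLength? w i = map′
  (λ (b , l) → take i w , b , l)
  (λ { (v , b , refl) →
       let e = prefix⇒take (IsBorder.prefix b) in
       subst (λ x → IsBorder x w) e b , cong length (sym e) })
  (isBorder? (take i w) w ×-dec (length (take i w) ℕ.≟ i))

bordered? : ∀ {k} (w : Word k) → Dec (Bordered w)
bordered? w = map′
  (λ (_ , _ , v , b , _) → v , b)
  (λ (v , b) →
     length v , s≤s (Prefix.length-mono (IsBorder.prefix b)) , v , b , refl)
  (ℕ.anyUpTo? (hasBorderOfLength? w) (suc (length w)))

unbordered? : ∀ {k} (w : Word k) → Dec (Unbordered w)
unbordered? w = ¬? (bordered? w)

-- words k m lists every word of length m over Σₖ exactly once, as the three
-- lemmas that follow show; hence counting in this list is counting words.
words : (k m : ℕ) → List (Word k)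
words k zero    = [] ∷ []
words k (suc m) = cartesianProductWith _∷_ (allFin k) (words k m)

words-complete : ∀ {k} (w : Word k) → w ∈ words k (length w)
words-complete []      = here refl
words-complete (x ∷ w) = ∈-cartesianProductWith⁺ _∷_ (∈-allFin x) (words-complete w)

words-sound : ∀ {k} m {w : Word k} → w ∈ words k m → length w ≡ m
words-sound zero (here refl) = refl
words-sound {k} (suc m) w∈
  with _ , _ , _ , v∈ , refl ← ∈-cartesianProductWith⁻ _∷_ (allFin k) (words k m) w∈
  = cong suc (words-sound m v∈)

words-unique : ∀ k m → Unique (words k m)
words-unique k zero    = All.[] ∷ []
words-unique k (suc m) =
  Unique.cartesianProductWith⁺ _∷_ ∷-injective (Unique.allFin⁺ k) (words-unique k m)

-- Bₖ(u,m)
B : (k : ℕ) → Word k → ℕ → ℕ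
B k u m = length (filter (λ w → isPrefix? u w ×-dec bordered? w) (words k m))

-- The arrays a[1..p] and b[1..p] of a word of length p are functions on ℕ,
-- meaningful for indices between 1 and p.
unborderedPrefixIndicator : ∀ {k} → Word k → ℕ → ℕ
unborderedPrefixIndicator u i = if does (unbordered? (take i u)) then 1 else 0

borderIndicator : ∀ {k} → Word k → ℕ → ℕ
borderIndicator u i = if does (hasBorderOfLength? u i) then 1 else 0

-- l, l+1, …, h; empty when h < l.
range : ℕ → ℕ → List ℕ
range l h = map (l +_) (upTo (suc h ∸ l))

Σℕ : ℕ → ℕ → (ℕ → ℕ) → ℕ
Σℕ l h f = sum (map f (range l h))

Σℤ : ℕ → ℕ → (ℕ → ℤ) → ℤ
Σℤ l h f = foldr ℤ._+_ ℤ.0ℤ (map f (range l h))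

syntax Σℕ l h (λ i → e) = Σℕ[ i from l to h ] e
syntax Σℤ l h (λ i → e) = Σℤ[ i from l to h ] e

{-# OPTIONS --safe #-}
module Submission where

-- A bordered word w has exactly one unbordered border, namely its shortest one,
-- and its length i is at most |w|/2, since otherwise its two occurrences would
-- overlap in a border of the border. So Bₖ(u,n) is the sum over 1 ≤ i ≤ ⌊n/2⌋ of
-- the number of words w = x y x with prefix u, |x| = i and x unbordered.
-- If i ≤ p then x is the prefix of u of length i, and either u ends inside x y
-- (leaving n-p-i free letters) or u reaches into the second x, where its part in
-- that x must be a border of u. If i > p then x is any unbordered word of length i
-- with prefix u, and y is free.

open import Defs
open import Algebra.Properties.CommutativeSemigroup using (interchange; x∙yz≈y∙xz)
open import Data.Bool.Base using (true; false; if_then_else_)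
open import Data.Integer.Base as ℤ using (ℤ; +_)
import Data.Integer.Properties as ℤ
open import Data.List.Base using (List; []; _∷_; _++_; length; map; filter; foldr; take; drop; upTo; applyUpTo; allFin; cartesianProductWith)
open import Data.List.Membership.Propositional using (_∈_)
open import Data.List.Membership.Propositional.Properties using (∈-map⁺; ∈-map⁻; ∈-upTo⁺; ∈-upTo⁻)
open import Data.List.Properties using (map-++; map-upTo; length-++; length-take; length-drop; length-tabulate; take++drop≡id; ++-assoc; ++-identityʳ; ∷-injectiveˡ; ∷-injectiveʳ)
open import Data.List.Relation.Binary.Pointwise using (Pointwise-≡⇒≡; ≡⇒Pointwise-≡)
import Data.List.Relation.Binary.Prefix.Heterogeneous as Prefix
import Data.List.Relation.Binary.Suffix.Heterogeneous as Suffix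
import Data.List.Relation.Unary.All as All
open import Data.List.Relation.Unary.AllPairs using ([]; _∷_)
open import Data.List.Relation.Unary.Any using (here; there)
open import Data.List.Relation.Unary.Unique.Propositional using (Unique)
import Data.List.Relation.Unary.Unique.Propositional.Properties as Unique
open import Data.Nat.Base using (ℕ; zero; suc; _+_; _*_; _∸_; _^_; _≤_; _<_; z≤n; s≤s; s≤s⁻¹; ⌊_/2⌋)
open import Data.Nat.Induction using (<-wellFounded; Acc; acc)
open import Data.Nat.ListAction using (sum)
open import Data.Nat.ListAction.Properties using (sum-++)
open import Data.Nat.Properties
open import Data.Nat.Tactic.RingSolver using (solve-∀)
open import Data.Product.Base using (∃; _×_; _,_; proj₁; proj₂)
open import Data.Sum.Base using (inj₁; inj₂)
open import Function.Base using (_∘_)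
open import Relation.Binary.PropositionalEquality using (_≡_; _≢_; refl; sym; trans; cong; cong₂; subst; module ≡-Reasoning)
open import Relation.Nullary.Decidable using (Dec; yes; no; does; ¬?; _×-dec_)
open import Relation.Nullary.Negation using (¬_; contradiction)

-- Sums over lists and indicators

∑ : {A : Set} → List A → (A → ℕ) → ℕ
∑ xs f = sum (map f xs)

module _ {A : Set} where

  ∑-cong-∈ : ∀ (xs : List A) {f g : A → ℕ} → (∀ {x} → x ∈ xs → f x ≡ g x) → ∑ xs f ≡ ∑ xs g
  ∑-cong-∈ []       h = refl
  ∑-cong-∈ (x ∷ xs) h = cong₂ _+_ (h (here refl)) (∑-cong-∈ xs (h ∘ there))

  ∑-cong : ∀ (xs : List A) {f g : A → ℕ} → (∀ x → f x ≡ g x) → ∑ xs f ≡ ∑ xs g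
  ∑-cong xs h = ∑-cong-∈ xs (λ {x} _ → h x)

  ∑-const : ∀ (xs : List A) c → ∑ xs (λ _ → c) ≡ length xs * c
  ∑-const []       c = refl
  ∑-const (x ∷ xs) c = cong (_+_ c) (∑-const xs c)

  ∑-zero : ∀ (xs : List A) {f : A → ℕ} → (∀ {x} → x ∈ xs → f x ≡ 0) → ∑ xs f ≡ 0
  ∑-zero xs h = trans (∑-cong-∈ xs h) (trans (∑-const xs 0) (*-zeroʳ (length xs)))

  ∑-+ : ∀ (xs : List A) (f g : A → ℕ) → ∑ xs (λ x → f x + g x) ≡ ∑ xs f + ∑ xs g
  ∑-+ []       f g = refl
  ∑-+ (x ∷ xs) f g = trans (cong (_+_ (f x + g x)) (∑-+ xs f g))
    (interchange +-commutativeSemigroup (f x) (g x) (∑ xs f) (∑ xs g))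

  ∑-*ˡ : ∀ (xs : List A) c (f : A → ℕ) → ∑ xs (λ x → c * f x) ≡ c * ∑ xs f
  ∑-*ˡ []       c f = sym (*-zeroʳ c)
  ∑-*ˡ (x ∷ xs) c f = trans (cong (_+_ (c * f x)) (∑-*ˡ xs c f)) (sym (*-distribˡ-+ c (f x) (∑ xs f)))

  ∑-++ : ∀ (xs ys : List A) (f : A → ℕ) → ∑ (xs ++ ys) f ≡ ∑ xs f + ∑ ys f
  ∑-++ xs ys f = trans (cong sum (map-++ f xs ys)) (sum-++ (map f xs) (map f ys))

  -- Serves sums over lengths, where only the length of the unbordered border contributes, and sums
  -- over words, where a prefix or suffix condition leaves one candidate. `Unique` ensures that the
  -- surviving entry is counted once.
  ∑-single : ∀ {xs : List A} {z} (f : A → ℕ) → Unique xs → z ∈ xs →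
             (∀ {x} → x ∈ xs → x ≢ z → f x ≡ 0) → ∑ xs f ≡ f z
  ∑-single {x ∷ xs} f (x∉ ∷ _) (here refl) h =
    trans (cong (_+_ (f x)) (∑-zero xs (λ y∈ → h (there y∈) (All.lookup x∉ y∈ ∘ sym)))) (+-identityʳ (f x))
  ∑-single {x ∷ xs} f (x∉ ∷ xs!) (there z∈) h =
    cong₂ _+_ (h (here refl) (All.lookup x∉ z∈)) (∑-single f xs! z∈ (h ∘ there))

∑-swap : ∀ {A C : Set} (xs : List A) (ys : List C) (f : A → C → ℕ) →
         ∑ xs (λ x → ∑ ys (f x)) ≡ ∑ ys (λ y → ∑ xs (λ x → f x y))
∑-swap []       ys f = sym (∑-zero ys (λ _ → refl))
∑-swap (x ∷ xs) ys f = trans (cong (_+_ (∑ ys (f x))) (∑-swap xs ys f))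
  (sym (∑-+ ys (f x) (λ y → ∑ xs (λ x′ → f x′ y))))

∑-map : ∀ {A C : Set} (g : A → C) xs (f : C → ℕ) → ∑ (map g xs) f ≡ ∑ xs (f ∘ g)
∑-map g []       f = refl
∑-map g (x ∷ xs) f = cong (_+_ (f (g x))) (∑-map g xs f)

∑-cartesianProductWith : ∀ {A C D : Set} (g : A → C → D) xs ys (f : D → ℕ) →
  ∑ (cartesianProductWith g xs ys) f ≡ ∑ xs (λ x → ∑ ys (λ y → f (g x y)))
∑-cartesianProductWith g []       ys f = refl
∑-cartesianProductWith g (x ∷ xs) ys f = trans (∑-++ (map (g x) ys) _ f)
  (cong₂ _+_ (∑-map (g x) ys f) (∑-cartesianProductWith g xs ys f))

-- Unfolds to the same conditional as `unborderedPrefixIndicator` and `borderIndicator`, so the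
-- arrays a and b are brackets of this kind by definition.
⟦_⟧ : {P : Set} → Dec P → ℕ
⟦ d ⟧ = if does d then 1 else 0

⟦⟧-true : {P : Set} (d : Dec P) → P → ⟦ d ⟧ ≡ 1
⟦⟧-true (yes _) p = refl
⟦⟧-true (no ¬p) p = contradiction p ¬p

⟦⟧-false : {P : Set} (d : Dec P) → ¬ P → ⟦ d ⟧ ≡ 0
⟦⟧-false (yes p) ¬p = contradiction p ¬p
⟦⟧-false (no _)  ¬p = refl

⟦⟧-cong : {P Q : Set} (d : Dec P) (e : Dec Q) → (P → Q) → (Q → P) → ⟦ d ⟧ ≡ ⟦ e ⟧
⟦⟧-cong (yes p) e f g = sym (⟦⟧-true e (f p))
⟦⟧-cong (no ¬p) e f g = sym (⟦⟧-false e (¬p ∘ g))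

⟦⟧-× : {P Q : Set} (d : Dec P) (e : Dec Q) → ⟦ d ×-dec e ⟧ ≡ ⟦ d ⟧ * ⟦ e ⟧
⟦⟧-× (yes _) (yes _) = refl
⟦⟧-× (yes _) (no _)  = refl
⟦⟧-× (no _)  e       = refl

⟦⟧-¬ : {P : Set} (d : Dec P) → ⟦ ¬? d ⟧ + ⟦ d ⟧ ≡ 1
⟦⟧-¬ (yes _) = refl
⟦⟧-¬ (no _)  = refl

length-filter-∑ : ∀ {A : Set} {P : A → Set} (P? : ∀ x → Dec (P x)) xs →
                  length (filter P? xs) ≡ ∑ xs (λ x → ⟦ P? x ⟧)
length-filter-∑ P? []       = refl
length-filter-∑ P? (x ∷ xs) with does (P? x)
... | true  = cong suc (length-filter-∑ P? xs)
... | false = length-filter-∑ P? xs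

-- Sums over integer ranges

m<n∸o⇒o+m<n : ∀ {m n} o → m < n ∸ o → o + m < n
m<n∸o⇒o+m<n         zero    lt = lt
m<n∸o⇒o+m<n {n = suc n} (suc o) lt = s≤s (m<n∸o⇒o+m<n o lt)

∈-range⁻ : ∀ l h {i} → i ∈ range l h → l ≤ i × i ≤ h
∈-range⁻ l h i∈ with j , j∈ , refl ← ∈-map⁻ (_+_ l) i∈ =
  m≤m+n l j , s≤s⁻¹ (m<n∸o⇒o+m<n l (∈-upTo⁻ j∈))

∈-range⁺ : ∀ l h {i} → l ≤ i → i ≤ h → i ∈ range l h
∈-range⁺ l h l≤i i≤h = subst (_∈ range l h) (m+[n∸m]≡n l≤i)
  (∈-map⁺ (_+_ l) (∈-upTo⁺ (∸-monoˡ-< (s≤s i≤h) l≤i)))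

range-unique : ∀ l h → Unique (range l h)
range-unique l h = Unique.map⁺ (+-cancelˡ-≡ l _ _) (Unique.upTo⁺ (suc h ∸ l))

applyUpTo-+ : ∀ {A : Set} (f : ℕ → A) m n →
              applyUpTo f (m + n) ≡ applyUpTo f m ++ applyUpTo (λ i → f (m + i)) n
applyUpTo-+ f zero    n = refl
applyUpTo-+ f (suc m) n = cong (f 0 ∷_) (applyUpTo-+ (f ∘ suc) m n)

range-split : ∀ {m h} → m ≤ h → range 1 h ≡ range 1 m ++ range (m + 1) h
-- With `m + 1` turned into `suc m`, the length `suc h ∸ suc m` of the second range reduces to
-- `h ∸ m`.
range-split {m} {h} m≤h rewrite +-comm m 1 = begin
  map suc (upTo h)                                     ≡⟨ map-upTo suc h ⟩
  applyUpTo suc h                                      ≡⟨ cong (applyUpTo suc) (m+[n∸m]≡n m≤h) ⟨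
  applyUpTo suc (m + (h ∸ m))                          ≡⟨ applyUpTo-+ suc m (h ∸ m) ⟩
  applyUpTo suc m ++ applyUpTo (_+_ (suc m)) (h ∸ m)   ≡⟨ cong₂ _++_ (map-upTo suc m) (map-upTo (_+_ (suc m)) (h ∸ m)) ⟨
  map suc (upTo m) ++ map (_+_ (suc m)) (upTo (h ∸ m)) ∎
  where open ≡-Reasoning

Σℕ-split : ∀ {m h} (f : ℕ → ℕ) → m ≤ h → Σℕ 1 h f ≡ Σℕ 1 m f + Σℕ (m + 1) h f
Σℕ-split {m} {h} f m≤h = trans (cong (λ r → ∑ r f) (range-split m≤h)) (∑-++ (range 1 m) (range (m + 1) h) f)

Σℕ-cong : ∀ l h {f g : ℕ → ℕ} → (∀ i → l ≤ i → i ≤ h → f i ≡ g i) → Σℕ l h f ≡ Σℕ l h g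
Σℕ-cong l h eq = ∑-cong-∈ (range l h) (λ i∈ → let l≤i , i≤h = ∈-range⁻ l h i∈ in eq _ l≤i i≤h)

-- The terms for lengths beyond p contain a true difference, so that part of the count has to pass
-- to the integers.
Σℕ⇒Σℤ : ∀ l h {f : ℕ → ℕ} {g : ℕ → ℤ} → (∀ i → l ≤ i → i ≤ h → + f i ≡ g i) → + Σℕ l h f ≡ Σℤ l h g
Σℕ⇒Σℤ l h {f} {g} eq = go (range l h) (λ i∈ → let l≤i , i≤h = ∈-range⁻ l h i∈ in eq _ l≤i i≤h)
  where
  go : ∀ xs → (∀ {i} → i ∈ xs → + f i ≡ g i) → + ∑ xs f ≡ foldr ℤ._+_ ℤ.0ℤ (map g xs)
  go []       h = refl
  go (x ∷ xs) h = trans (ℤ.pos-+ (f x) (∑ xs f)) (cong₂ ℤ._+_ (h (here refl)) (go xs (h ∘ there)))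

-- Prefixes, suffixes and borders

module _ {A : Set} where

  -- Levi's lemma, in the case where `x` is the shorter left factor.
  ++-splitˡ : ∀ (x : List A) {y} s {t} → x ++ y ≡ s ++ t → length x ≤ length s →
              ∃ λ z → s ≡ x ++ z × y ≡ z ++ t
  ++-splitˡ []      s       eq _  = s , refl , eq
  ++-splitˡ (a ∷ x) (b ∷ s) eq le with z , refl , eq₂ ← ++-splitˡ x s (∷-injectiveʳ eq) (s≤s⁻¹ le) =
    z , cong (_∷ x ++ z) (sym (∷-injectiveˡ eq)) , eq₂

  ++-injective : ∀ (x : List A) {y} s {t} → length x ≡ length s → x ++ y ≡ s ++ t → x ≡ s × y ≡ t
  ++-injective x s len eq with ++-splitˡ x s eq (≤-reflexive len)
  ... | []    , s≡ , y≡ = sym (trans s≡ (++-identityʳ x)) , y≡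
  ... | b ∷ z , s≡ , _  = contradiction
    (trans len (trans (cong length s≡) (trans (length-++ x) (+-suc (length x) (length z)))))
    (m≢1+m+n (length x))

  take-++ : ∀ (x : List A) {y} → take (length x) (x ++ y) ≡ x
  take-++ []      = refl
  take-++ (a ∷ x) = cong (a ∷_) (take-++ x)

  length-take-≤ : ∀ {i} (x : List A) → i ≤ length x → length (take i x) ≡ i
  length-take-≤ {i} x le = trans (length-take i x) (m≤n⇒m⊓n≡m le)

module _ {k : ℕ} where

  prefix⁻ : ∀ {v w : Word k} → IsPrefix v w → ∃ λ r → v ++ r ≡ w
  prefix⁻ p with e Prefix.++ r ← Prefix.toView p = r , cong (_++ r) (Pointwise-≡⇒≡ e)

  prefix⁺ : ∀ (v : Word k) r → IsPrefix v (v ++ r)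
  prefix⁺ v r = Prefix.fromView (≡⇒Pointwise-≡ refl Prefix.++ r)

  suffix⁻ : ∀ {v w : Word k} → IsSuffix v w → ∃ λ s → s ++ v ≡ w
  suffix⁻ p with s Suffix.++ e ← Suffix.toView p = s , cong (s ++_) (Pointwise-≡⇒≡ e)

  suffix⁺ : ∀ s (v : Word k) → IsSuffix v (s ++ v)
  suffix⁺ s v = Suffix.fromView (s Suffix.++ ≡⇒Pointwise-≡ refl)

  take-prefix : ∀ i (w : Word k) → IsPrefix (take i w) w
  take-prefix i w = subst (IsPrefix (take i w)) (take++drop≡id i w) (prefix⁺ (take i w) (drop i w))

  prefix-++ˡ : ∀ (v : Word k) {x y} → length v ≤ length x → IsPrefix v (x ++ y) → IsPrefix v x
  prefix-++ˡ v {x} le p with r , eq ← prefix⁻ p with z , refl , _ ← ++-splitˡ v x eq le = prefix⁺ v z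

  prefix-++ʳ : ∀ (x : Word k) {v y} → IsPrefix v y → IsPrefix (x ++ v) (x ++ y)
  prefix-++ʳ x {v} p with r , refl ← prefix⁻ p =
    subst (IsPrefix (x ++ v)) (++-assoc x v r) (prefix⁺ (x ++ v) r)

  prefix-++⁻ : ∀ (x : Word k) {v} s {y} → length x ≡ length s → IsPrefix (x ++ v) (s ++ y) → x ≡ s × IsPrefix v y
  prefix-++⁻ x {v} s len p with r , eq ← prefix⁻ p
    with refl , refl ← ++-injective x s len (trans (sym (++-assoc x v r)) eq) = refl , prefix⁺ v r

  prefixes-comparable : ∀ {x y w : Word k} → length x ≤ length y → IsPrefix x w → IsPrefix y w → IsPrefix x y
  prefixes-comparable {x} le p q with r , refl ← prefix⁻ q = prefix-++ˡ x le p

  -- Levi's lemma is applied to the two parts cut off in front, whichever of them is shorter.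
  suffixes-comparable : ∀ {x y w : Word k} → length x ≤ length y → IsSuffix x w → IsSuffix y w → IsSuffix x y
  suffixes-comparable {x} {y} le p q
    with s , refl ← suffix⁻ p with t , eq ← suffix⁻ q
    with ≤-total (length t) (length s)
  ... | inj₁ t≤s with z , _ , refl ← ++-splitˡ t s eq t≤s = suffix⁺ z x
  ... | inj₂ s≤t with z , _ , refl ← ++-splitˡ s t (sym eq) s≤t with z
  ...   | []    = suffix⁺ [] y
  -- A non-empty remainder would make the shorter suffix strictly longer than `y`.
  ...   | c ∷ z = contradiction (≤-trans le (m≤n+m (length y) (length z)))
                    (<⇒≱ (s≤s (≤-reflexive (sym (length-++ z)))))

  prefix-trans : ∀ {x y w : Word k} → IsPrefix x y → IsPrefix y w → IsPrefix x w
  prefix-trans {x} p q with r , refl ← prefix⁻ p with s , refl ← prefix⁻ q =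
    subst (IsPrefix x) (sym (++-assoc x r s)) (prefix⁺ x (r ++ s))

  suffix-trans : ∀ {x y w : Word k} → IsSuffix x y → IsSuffix y w → IsSuffix x w
  suffix-trans {x} p q with r , refl ← suffix⁻ p with s , refl ← suffix⁻ q =
    subst (IsSuffix x) (++-assoc s r x) (suffix⁺ (s ++ r) x)

  length≢0 : ∀ {v : Word k} → v ≢ [] → 1 ≤ length v
  length≢0 {[]}    ne = contradiction refl ne
  length≢0 {_ ∷ _} _  = s≤s z≤n

  border-length : ∀ {v w : Word k} → IsBorder v w → length v < length w
  border-length {v} (mkBorder _ pr p _) with prefix⁻ p
  ... | []    , refl = contradiction (sym (++-identityʳ v)) pr
  ... | c ∷ r , refl = subst (length v <_) (sym (length-++ v)) (m<m+n (length v) (s≤s z≤n))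

  -- Length bounds replace the two inequations of `IsBorder`, since lengths are what the counting
  -- arguments control.
  border-intro : ∀ {v w : Word k} → 1 ≤ length v → length v < length w → IsPrefix v w → IsSuffix v w → IsBorder v w
  border-intro 1≤ lt = mkBorder (λ { refl → n≮0 1≤ }) (λ { refl → <-irrefl refl lt })

  -- Existence, uniqueness and length of the unbordered border

  UnborderedBorder : Word k → Word k → Set
  UnborderedBorder w v = IsBorder v w × Unbordered v

  -- A border of a border of w is again a border of w and is shorter, so the descent from any border
  -- ends at an unbordered one.
  unborderedBorder : ∀ {w : Word k} → Bordered w → ∃ (UnborderedBorder w)
  unborderedBorder (v , b) = go v b (<-wellFounded (length v))
    where
    go : ∀ {w} v → IsBorder v w → Acc _<_ (length v) → ∃ (UnborderedBorder w)
    go v b (acc rs) with bordered? v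
    ... | no ¬b = v , b , ¬b
    ... | yes (x , bx) = go x
      (border-intro (length≢0 (IsBorder.nonEmpty bx)) (<-trans (border-length bx) (border-length b))
        (prefix-trans (IsBorder.prefix bx) (IsBorder.prefix b))
        (suffix-trans (IsBorder.suffix bx) (IsBorder.suffix b)))
      (rs (border-length bx))

  -- A strictly shorter border of w would be both a prefix and a suffix of `v`, hence a border of
  -- `v`. Used in both directions, this makes the length unique.
  unborderedBorder-≤ : ∀ {v w v′ : Word k} → UnborderedBorder w v → UnborderedBorder w v′ → length v ≤ length v′
  unborderedBorder-≤ {v} {w} {v′} (b , ub) (b′ , ub′) = ≮⇒≥ λ lt → ub
    (v′ , border-intro (length≢0 (IsBorder.nonEmpty b′)) lt
      (prefixes-comparable (<⇒≤ lt) (IsBorder.prefix b′) (IsBorder.prefix b))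
      (suffixes-comparable (<⇒≤ lt) (IsBorder.suffix b′) (IsBorder.suffix b)))

  -- If the two occurrences of v overlapped, the overlap would be a border of v.
  unborderedBorder-half : ∀ {v w : Word k} → UnborderedBorder w v → length v ≤ ⌊ length w /2⌋
  unborderedBorder-half {v} {w} (b , ub)
    with r , refl ← prefix⁻ (IsBorder.prefix b) with s , eq ← suffix⁻ (IsBorder.suffix b)
    with ≤-<-connex (length v) (length s)
  ... | inj₁ v≤s = subst (_≤ ⌊ length (v ++ r) /2⌋) (sym (n≡⌊n+n/2⌋ (length v)))
        (⌊n/2⌋-mono (≤-trans (+-monoˡ-≤ (length v) v≤s)
          (≤-reflexive (trans (sym (length-++ s)) (cong length eq)))))
  ... | inj₂ s<v with t , refl , eq₂ ← ++-splitˡ s v eq (<⇒≤ s<v) = contradiction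
        (t , border-intro 1≤t t<v (subst (IsPrefix t) (sym eq₂) (prefix⁺ t r)) (suffix⁺ s t)) ub
    where
    lenv : length (s ++ t) ≡ length s + length t
    lenv = length-++ s
    1≤t : 1 ≤ length t
    1≤t = +-cancelˡ-< (length s) 0 (length t) (subst (_< length s + length t) (sym (+-identityʳ (length s)))
      (subst (length s <_) lenv s<v))
    -- An empty `s` would make the border as long as the whole word.
    1≤s : 1 ≤ length s
    1≤s = n≢0⇒n>0 λ e → <-irrefl
      (trans (cong (_+ length (s ++ t)) (sym e)) (trans (sym (length-++ s)) (cong length eq)))
      (border-length b)
    t<v : length t < length (s ++ t)
    t<v = subst (length t <_) (sym lenv) (+-monoˡ-≤ (length t) 1≤s)

  -- For i between 1 and half the length of w this is 1 exactly when `take i w` is an unbordered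
  -- border, because being a non-empty proper prefix is then automatic. The product form lets the
  -- first factor be pulled out of sums.
  shortBorder : Word k → ℕ → ℕ
  shortBorder w i = ⟦ unbordered? (take i w) ⟧ * ⟦ isSuffix? (take i w) w ⟧

  shortBorder-zero : ∀ {w : Word k} {i} → 1 ≤ i → i ≤ ⌊ length w /2⌋ →
                     ¬ UnborderedBorder w (take i w) → shortBorder w i ≡ 0
  shortBorder-zero {w} {i} 1≤i i≤ ¬ub = trans
    (sym (⟦⟧-× (unbordered? (take i w)) (isSuffix? (take i w) w)))
    (⟦⟧-false (unbordered? (take i w) ×-dec isSuffix? (take i w) w) λ (ub , suf) → ¬ub
      (border-intro (subst (1 ≤_) (sym len) 1≤i) (subst (_< length w) (sym len) i<) (take-prefix i w) suf , ub))
    where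
    i< : i < length w
    i< with length w
    -- The empty word is the one case where half the length is not below the length; `1 ≤ i`
    -- excludes it.
    ... | zero  = contradiction 1≤i (<⇒≱ (s≤s i≤))
    ... | suc n = ≤-<-trans i≤ (⌊n/2⌋<n n)
    len : length (take i w) ≡ i
    len = length-take-≤ w (<⇒≤ i<)

  -- If w is bordered, the half-length bound puts the length of its unbordered border in the range,
  -- and uniqueness makes every other term vanish.
  bordered-∑ : ∀ (w : Word k) → ⟦ bordered? w ⟧ ≡ Σℕ 1 ⌊ length w /2⌋ (shortBorder w)
  bordered-∑ w = go (bordered? w)
    where
    go : (d : Dec (Bordered w)) → ⟦ d ⟧ ≡ Σℕ 1 ⌊ length w /2⌋ (shortBorder w)
    go (no ¬b) = sym (∑-zero (range 1 ⌊ length w /2⌋) λ i∈ →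
      let 1≤i , i≤ = ∈-range⁻ 1 _ i∈ in shortBorder-zero 1≤i i≤ (λ (b , _) → ¬b (_ , b)))
    go (yes bd) with v , b , ub ← unborderedBorder bd = sym (trans
      (∑-single (shortBorder w) (range-unique 1 _)
        (∈-range⁺ 1 _ (length≢0 (IsBorder.nonEmpty b)) (unborderedBorder-half (b , ub)))
        (λ {i} i∈ i≢ → let 1≤i , i≤ = ∈-range⁻ 1 _ i∈ in shortBorder-zero 1≤i i≤ λ ub′ → i≢
          (trans (sym (length-take-≤ w (≤-trans i≤ (⌊n/2⌋≤n _))))
            (≤-antisym (unborderedBorder-≤ ub′ (b , ub)) (unborderedBorder-≤ (b , ub) ub′)))))
      (cong₂ _*_ (⟦⟧-true (unbordered? (take (length v) w)) (subst Unbordered v≡ ub))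
                 (⟦⟧-true (isSuffix? (take (length v) w) w) (subst (λ x → IsSuffix x w) v≡ (IsBorder.suffix b)))))
      where
      v≡ : v ≡ take (length v) w
      v≡ = prefix⇒take (IsBorder.prefix b)

  prefix-≡ : ∀ {v : Word k} x {y} → length v ≡ length x → IsPrefix v (x ++ y) → v ≡ x
  prefix-≡ {v} x len p with r , eq ← prefix⁻ p = proj₁ (++-injective v x len eq)

  suffix-≡ : ∀ {x z w : Word k} → length x ≡ length z → IsSuffix x w → IsSuffix z w → x ≡ z
  suffix-≡ {x} len p q with suffix⁻ (suffixes-comparable (≤-reflexive len) p q)
  ... | []    , eq   = eq
  ... | c ∷ t , refl = contradiction len (<⇒≢ (s≤s (≤-trans (m≤n+m (length x) (length t)) (≤-reflexive (sym (length-++ t))))))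

  -- The source of the array b. A suffix `s` of u that also begins u is a border; conversely, a
  -- border of that length is a suffix as long as `s`, so it equals `s`.
  ⟦prefix⟧-border : ∀ {u s : Word k} i → IsSuffix s u → 1 ≤ length s → length s < length u →
                    length s ≤ i → i ≤ length u → ⟦ isPrefix? s (take i u) ⟧ ≡ borderIndicator u (length s)
  ⟦prefix⟧-border {u} {s} i suf 1≤ s<u s≤i i≤u = ⟦⟧-cong (isPrefix? s (take i u)) (hasBorderOfLength? u (length s))
    (λ p → s , border-intro 1≤ s<u (prefix-trans p (take-prefix i u)) suf , refl)
    (λ (v , b , len) → subst (λ x → IsPrefix x (take i u)) (suffix-≡ len (IsBorder.suffix b) suf)
      (prefixes-comparable (subst (length v ≤_) (sym (length-take-≤ u i≤u)) (subst (_≤ i) (sym len) s≤i))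
        (IsBorder.prefix b) (take-prefix i u)))

-- Counting words

module _ {k : ℕ} where

  ∑-words-++ : ∀ m n (f : Word k → ℕ) →
    ∑ (words k (m + n)) f ≡ ∑ (words k m) (λ x → ∑ (words k n) (λ y → f (x ++ y)))
  ∑-words-++ zero    n f = sym (+-identityʳ (∑ (words k n) f))
  ∑-words-++ (suc m) n f = begin
    ∑ (words k (suc m + n)) f
      ≡⟨ ∑-cartesianProductWith _∷_ (allFin k) (words k (m + n)) f ⟩
    ∑ (allFin k) (λ c → ∑ (words k (m + n)) (λ w → f (c ∷ w)))
      ≡⟨ ∑-cong (allFin k) (λ c → ∑-words-++ m n (λ w → f (c ∷ w))) ⟩
    ∑ (allFin k) (λ c → ∑ (words k m) (λ x → ∑ (words k n) (λ y → f (c ∷ x ++ y))))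
      ≡⟨ ∑-cartesianProductWith _∷_ (allFin k) (words k m) (λ x → ∑ (words k n) (λ y → f (x ++ y))) ⟨
    ∑ (words k (suc m)) (λ x → ∑ (words k n) (λ y → f (x ++ y))) ∎
    where open ≡-Reasoning

  ∑-words-const : ∀ m c → ∑ (words k m) (λ _ → c) ≡ k ^ m * c
  ∑-words-const zero    c = refl
  ∑-words-const (suc m) c = begin
    ∑ (words k (suc m)) (λ _ → c)
      ≡⟨ ∑-cartesianProductWith _∷_ (allFin k) (words k m) (λ _ → c) ⟩
    ∑ (allFin k) (λ _ → ∑ (words k m) (λ _ → c)) ≡⟨ ∑-const (allFin k) _ ⟩
    length (allFin k) * ∑ (words k m) (λ _ → c) ≡⟨ cong₂ _*_ (length-tabulate {n = k} (λ i → i)) (∑-words-const m c) ⟩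
    k * (k ^ m * c)                             ≡⟨ *-assoc k (k ^ m) c ⟨
    k ^ suc m * c                               ∎
    where open ≡-Reasoning

  ∑-words-single : ∀ {m} (f : Word k → ℕ) z → length z ≡ m →
    (∀ x → length x ≡ m → x ≢ z → f x ≡ 0) → ∑ (words k m) f ≡ f z
  ∑-words-single f z refl h = ∑-single f (words-unique k (length z)) (words-complete z)
    (λ x∈ → h _ (words-sound (length z) x∈))

  ∑-words-cong : ∀ m {f g : Word k → ℕ} → (∀ x → length x ≡ m → f x ≡ g x) → ∑ (words k m) f ≡ ∑ (words k m) g
  ∑-words-cong m h = ∑-cong-∈ (words k m) (λ x∈ → h _ (words-sound m x∈))

  -- The first `length v` letters of y are forced and the other d are free.
  ∑-prefix-long : ∀ (v t : Word k) d → ∑ (words k (length v + d)) (λ y → ⟦ isPrefix? v (y ++ t) ⟧) ≡ k ^ d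
  ∑-prefix-long v t d = begin
    ∑ (words k (length v + d)) (λ y → ⟦ isPrefix? v (y ++ t) ⟧)
      ≡⟨ ∑-words-++ (length v) d _ ⟩
    ∑ (words k (length v)) (λ x → ∑ (words k d) (λ y → ⟦ isPrefix? v ((x ++ y) ++ t) ⟧))
      ≡⟨ ∑-words-single _ v refl (λ x len x≢v → ∑-zero (words k d) λ {y} _ → ⟦⟧-false (isPrefix? v ((x ++ y) ++ t))
           (λ p → x≢v (sym (prefix-≡ x (sym len) (subst (IsPrefix v) (++-assoc x y t) p))))) ⟩
    ∑ (words k d) (λ y → ⟦ isPrefix? v ((v ++ y) ++ t) ⟧)
      ≡⟨ ∑-cong (words k d) (λ y → ⟦⟧-true (isPrefix? v ((v ++ y) ++ t)) (prefix⁺ v y Prefix.++ᵖ t)) ⟩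
    ∑ (words k d) (λ _ → 1) ≡⟨ ∑-words-const d 1 ⟩
    k ^ d * 1               ≡⟨ *-identityʳ (k ^ d) ⟩
    k ^ d                   ∎
    where open ≡-Reasoning

  ⟦isPrefix⟧-drop : ∀ j (v t : Word k) → ⟦ isPrefix? v (take j v ++ t) ⟧ ≡ ⟦ isPrefix? (drop j v) t ⟧
  ⟦isPrefix⟧-drop j v t = ⟦⟧-cong (isPrefix? v (take j v ++ t)) (isPrefix? (drop j v) t)
    (λ p → proj₂ (prefix-++⁻ (take j v) (take j v) refl
      (subst (λ x → IsPrefix x (take j v ++ t)) (sym (take++drop≡id j v)) p)))
    (λ p → subst (λ x → IsPrefix x (take j v ++ t)) (take++drop≡id j v) (prefix-++ʳ (take j v) p))

  isPrefix-take : ∀ {j} {v : Word k} y {t} → j ≤ length v → length y ≡ j → IsPrefix v (y ++ t) → y ≡ take j v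
  isPrefix-take {j} {v} y {t} j≤ len p = sym (prefix-≡ y (trans (length-take-≤ v j≤) (sym len))
    (prefix-trans (take-prefix j v) p))

  -- Here y is forced to be `take j v`, and what is left of v has to begin `t`.
  ∑-prefix-short : ∀ (v t : Word k) {j} → j ≤ length v →
    ∑ (words k j) (λ y → ⟦ isPrefix? v (y ++ t) ⟧) ≡ ⟦ isPrefix? (drop j v) t ⟧
  ∑-prefix-short v t {j} j≤ = trans
    (∑-words-single _ (take j v) (length-take-≤ v j≤) (λ y len y≢ →
      ⟦⟧-false (isPrefix? v (y ++ t)) (λ p → y≢ (isPrefix-take y j≤ len p))))
    (⟦isPrefix⟧-drop j v t)

  -- For i between 1 and half of n, the number of length-n words with prefix u whose unbordered
  -- border has length i.
  borderCount : Word k → ℕ → ℕ → ℕ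
  borderCount u n i = ∑ (words k n) (λ w → ⟦ isPrefix? u w ⟧ * shortBorder w i)

  B-∑ : ∀ u n → B k u n ≡ ∑ (words k n) (λ w → ⟦ isPrefix? u w ⟧ * ⟦ bordered? w ⟧)
  B-∑ u n = trans (length-filter-∑ (λ w → isPrefix? u w ×-dec bordered? w) (words k n))
    (∑-cong (words k n) (λ w → ⟦⟧-× (isPrefix? u w) (bordered? w)))

  B-borderCount : ∀ u n → B k u n ≡ Σℕ 1 ⌊ n /2⌋ (borderCount u n)
  B-borderCount u n = begin
    B k u n
      ≡⟨ B-∑ u n ⟩
    ∑ (words k n) (λ w → ⟦ isPrefix? u w ⟧ * ⟦ bordered? w ⟧)
      ≡⟨ ∑-words-cong n (λ { w refl → trans (cong (⟦ isPrefix? u w ⟧ *_) (bordered-∑ w))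
           (sym (∑-*ˡ (range 1 ⌊ n /2⌋) ⟦ isPrefix? u w ⟧ (shortBorder w))) }) ⟩
    ∑ (words k n) (λ w → Σℕ 1 ⌊ n /2⌋ (λ i → ⟦ isPrefix? u w ⟧ * shortBorder w i))
      ≡⟨ ∑-swap (words k n) (range 1 ⌊ n /2⌋) (λ w i → ⟦ isPrefix? u w ⟧ * shortBorder w i) ⟩
    Σℕ 1 ⌊ n /2⌋ (borderCount u n) ∎
    where open ≡-Reasoning

  shortBorder-++ : ∀ {i} (x r : Word k) → length x ≡ i →
    shortBorder (x ++ r) i ≡ ⟦ unbordered? x ⟧ * ⟦ isSuffix? x (x ++ r) ⟧
  shortBorder-++ x r refl = cong (λ v → ⟦ unbordered? v ⟧ * ⟦ isSuffix? v (x ++ r) ⟧) (take-++ x)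

  -- Cut the word as x y z with outer blocks of length i and middle block of length j. The border
  -- condition forces z to be x, so only x and y remain to be summed over.
  borderCount-factor : ∀ u i j → borderCount u (i + (j + i)) i ≡
    ∑ (words k i) (λ x → ⟦ unbordered? x ⟧ * ∑ (words k j) (λ y → ⟦ isPrefix? u (x ++ (y ++ x)) ⟧))
  borderCount-factor u i j = trans (∑-words-++ i (j + i) _) (∑-words-cong i λ x lx →
    trans (∑-words-++ j i _) (trans (∑-words-cong j λ y _ → inner x lx y)
      (∑-*ˡ (words k j) ⟦ unbordered? x ⟧ (λ y → ⟦ isPrefix? u (x ++ (y ++ x)) ⟧))))
    where
    open ≡-Reasoning
    inner : ∀ x → length x ≡ i → ∀ y →
      ∑ (words k i) (λ z → ⟦ isPrefix? u (x ++ (y ++ z)) ⟧ * shortBorder (x ++ (y ++ z)) i)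
      ≡ ⟦ unbordered? x ⟧ * ⟦ isPrefix? u (x ++ (y ++ x)) ⟧
    inner x lx y = begin
      ∑ (words k i) (λ z → ⟦ isPrefix? u (x ++ (y ++ z)) ⟧ * shortBorder (x ++ (y ++ z)) i)
        ≡⟨ ∑-cong (words k i) (λ z → cong (⟦ isPrefix? u (x ++ (y ++ z)) ⟧ *_) (shortBorder-++ x (y ++ z) lx)) ⟩
      ∑ (words k i) (λ z → ⟦ isPrefix? u (x ++ (y ++ z)) ⟧ * (⟦ unbordered? x ⟧ * ⟦ isSuffix? x (x ++ (y ++ z)) ⟧))
        -- If x is a suffix, then x and z are suffixes of equal length of one word, so they agree.
        ≡⟨ ∑-words-single _ x lx (λ z lz z≢x → trans
             (cong (λ c → ⟦ isPrefix? u (x ++ (y ++ z)) ⟧ * (⟦ unbordered? x ⟧ * c))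
               (⟦⟧-false (isSuffix? x (x ++ (y ++ z))) (λ suf → z≢x (sym (suffix-≡ (trans lx (sym lz)) suf (xyz-suffix z))))))
             (trans (cong (⟦ isPrefix? u (x ++ (y ++ z)) ⟧ *_) (*-zeroʳ ⟦ unbordered? x ⟧))
               (*-zeroʳ ⟦ isPrefix? u (x ++ (y ++ z)) ⟧))) ⟩
      ⟦ isPrefix? u (x ++ (y ++ x)) ⟧ * (⟦ unbordered? x ⟧ * ⟦ isSuffix? x (x ++ (y ++ x)) ⟧)
        ≡⟨ cong (λ c → ⟦ isPrefix? u (x ++ (y ++ x)) ⟧ * (⟦ unbordered? x ⟧ * c))
             (⟦⟧-true (isSuffix? x (x ++ (y ++ x))) (xyz-suffix x)) ⟩
      ⟦ isPrefix? u (x ++ (y ++ x)) ⟧ * (⟦ unbordered? x ⟧ * 1)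
        ≡⟨ cong (⟦ isPrefix? u (x ++ (y ++ x)) ⟧ *_) (*-identityʳ ⟦ unbordered? x ⟧) ⟩
      ⟦ isPrefix? u (x ++ (y ++ x)) ⟧ * ⟦ unbordered? x ⟧
        ≡⟨ *-comm ⟦ isPrefix? u (x ++ (y ++ x)) ⟧ ⟦ unbordered? x ⟧ ⟩
      ⟦ unbordered? x ⟧ * ⟦ isPrefix? u (x ++ (y ++ x)) ⟧ ∎
      where
      xyz-suffix : ∀ z → IsSuffix z (x ++ (y ++ z))
      xyz-suffix z = subst (IsSuffix z) (++-assoc x y z) (suffix⁺ (x ++ y) z)

  -- The block x lies within u, so it must be `take i u`; its unborderedness is the factor a[i].
  borderCount-inside : ∀ u {i} j → i ≤ length u → borderCount u (i + (j + i)) i ≡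
    unborderedPrefixIndicator u i * ∑ (words k j) (λ y → ⟦ isPrefix? (drop i u) (y ++ take i u) ⟧)
  borderCount-inside u {i} j i≤ = trans (borderCount-factor u i j) (trans
    (∑-words-single _ (take i u) (length-take-≤ u i≤) (λ x lx x≢ → trans
      (cong (⟦ unbordered? x ⟧ *_) (∑-zero (words k j) λ {y} _ →
        ⟦⟧-false (isPrefix? u (x ++ (y ++ x))) (λ p → x≢ (isPrefix-take x i≤ lx p))))
      (*-zeroʳ ⟦ unbordered? x ⟧)))
    (cong (unborderedPrefixIndicator u i *_) (∑-cong (words k j) λ y → ⟦isPrefix⟧-drop i u (y ++ take i u))))

  -- u ends inside x y: it fixes the first d letters of y and leaves e free.
  borderCount-disjoint : ∀ u i d e → length u ≡ i + d →
    borderCount u (i + ((d + e) + i)) i ≡ unborderedPrefixIndicator u i * k ^ e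
  borderCount-disjoint u i d e len = trans
    (borderCount-inside u (d + e) (subst (i ≤_) (sym len) (m≤m+n i d)))
    (cong (unborderedPrefixIndicator u i *_)
      (subst (λ m → ∑ (words k (m + e)) (λ y → ⟦ isPrefix? (drop i u) (y ++ take i u) ⟧) ≡ k ^ e)
        (trans (length-drop i u) (trans (cong (_∸ i) len) (m+n∸m≡n i d)))
        (∑-prefix-long (drop i u) (take i u) e)))

  -- u covers x and y and the first l letters of the second x. So y is forced, and the last l
  -- letters of u must also begin u.
  borderCount-overlap : ∀ u i j l → length u ≡ i + (j + l) → 1 ≤ l → l ≤ i →
    borderCount u (i + (j + i)) i ≡ unborderedPrefixIndicator u i * borderIndicator u l
  borderCount-overlap u i j l len 1≤l l≤i = trans
    (borderCount-inside u j i≤u)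
    (cong (unborderedPrefixIndicator u i *_) (trans
      (∑-prefix-short (drop i u) (take i u) (subst (j ≤_) (sym lenᵢ) (m≤m+n j l)))
      (trans (⟦prefix⟧-border i suf (subst (1 ≤_) (sym lenₛ) 1≤l) (subst (_< length u) (sym lenₛ) l<u)
               (subst (_≤ i) (sym lenₛ) l≤i) i≤u)
        (cong (borderIndicator u) lenₛ))))
    where
    i≤u : i ≤ length u
    i≤u = subst (i ≤_) (sym len) (m≤m+n i (j + l))
    lenᵢ : length (drop i u) ≡ j + l
    lenᵢ = trans (length-drop i u) (trans (cong (_∸ i) len) (m+n∸m≡n i (j + l)))
    lenₛ : length (drop j (drop i u)) ≡ l
    lenₛ = trans (length-drop j (drop i u)) (trans (cong (_∸ j) lenᵢ) (m+n∸m≡n j l))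
    l<u : l < length u
    l<u = subst (l <_) (sym len) (+-mono-≤ (≤-trans 1≤l l≤i) (m≤n+m l j))
    drop-suffix : ∀ m (w : Word k) → IsSuffix (drop m w) w
    drop-suffix m w = subst (IsSuffix (drop m w)) (take++drop≡id m w) (suffix⁺ (take m w) (drop m w))
    suf : IsSuffix (drop j (drop i u)) u
    suf = suffix-trans (drop-suffix j (drop i u)) (drop-suffix i u)

  unborderedCount : Word k → ℕ → ℕ
  unborderedCount u i = ∑ (words k i) (λ x → ⟦ unbordered? x ⟧ * ⟦ isPrefix? u x ⟧)

  -- Each of the `k ^ d` extensions of u is either unbordered or bordered. Stating this as a sum
  -- avoids truncated subtraction.
  unborderedCount+B : ∀ u d → unborderedCount u (length u + d) + B k u (length u + d) ≡ k ^ d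
  unborderedCount+B u d = begin
    unborderedCount u i + B k u i
      ≡⟨ cong (_+_ (unborderedCount u i)) (B-∑ u i) ⟩
    unborderedCount u i + ∑ (words k i) (λ x → ⟦ isPrefix? u x ⟧ * ⟦ bordered? x ⟧)
      ≡⟨ ∑-+ (words k i) (λ x → ⟦ unbordered? x ⟧ * ⟦ isPrefix? u x ⟧) (λ x → ⟦ isPrefix? u x ⟧ * ⟦ bordered? x ⟧) ⟨
    ∑ (words k i) (λ x → ⟦ unbordered? x ⟧ * ⟦ isPrefix? u x ⟧ + ⟦ isPrefix? u x ⟧ * ⟦ bordered? x ⟧)
      ≡⟨ ∑-cong (words k i) pointwise ⟩
    -- The empty tail brings the sum into the shape of `∑-prefix-long`.
    ∑ (words k i) (λ x → ⟦ isPrefix? u (x ++ []) ⟧)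
      ≡⟨ ∑-prefix-long u [] d ⟩
    k ^ d ∎
    where
    open ≡-Reasoning
    i = length u + d
    pointwise : ∀ x → ⟦ unbordered? x ⟧ * ⟦ isPrefix? u x ⟧ + ⟦ isPrefix? u x ⟧ * ⟦ bordered? x ⟧ ≡ ⟦ isPrefix? u (x ++ []) ⟧
    pointwise x = begin
      ⟦ unbordered? x ⟧ * ⟦ isPrefix? u x ⟧ + ⟦ isPrefix? u x ⟧ * ⟦ bordered? x ⟧
        ≡⟨ cong (_+_ (⟦ unbordered? x ⟧ * ⟦ isPrefix? u x ⟧)) (*-comm ⟦ isPrefix? u x ⟧ ⟦ bordered? x ⟧) ⟩
      ⟦ unbordered? x ⟧ * ⟦ isPrefix? u x ⟧ + ⟦ bordered? x ⟧ * ⟦ isPrefix? u x ⟧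
        ≡⟨ *-distribʳ-+ ⟦ isPrefix? u x ⟧ ⟦ unbordered? x ⟧ ⟦ bordered? x ⟧ ⟨
      (⟦ unbordered? x ⟧ + ⟦ bordered? x ⟧) * ⟦ isPrefix? u x ⟧
        ≡⟨ cong (_* ⟦ isPrefix? u x ⟧) (⟦⟧-¬ (bordered? x)) ⟩
      1 * ⟦ isPrefix? u x ⟧ ≡⟨ *-identityˡ ⟦ isPrefix? u x ⟧ ⟩
      ⟦ isPrefix? u x ⟧     ≡⟨ cong (λ w → ⟦ isPrefix? u w ⟧) (++-identityʳ x) ⟨
      ⟦ isPrefix? u (x ++ []) ⟧ ∎

  -- All of u lies in the first x, so the prefix condition concerns x alone and y is free.
  borderCount-outside : ∀ u {i} j → length u ≤ i →
    borderCount u (i + (j + i)) i ≡ unborderedCount u i * k ^ j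
  borderCount-outside u {i} j u≤i = trans (borderCount-factor u i j) (trans (∑-words-cong i pointwise)
    (trans (∑-*ˡ (words k i) (k ^ j) (λ x → ⟦ unbordered? x ⟧ * ⟦ isPrefix? u x ⟧)) (*-comm (k ^ j) _)))
    where
    open ≡-Reasoning
    pointwise : ∀ x → length x ≡ i → ⟦ unbordered? x ⟧ * ∑ (words k j) (λ y → ⟦ isPrefix? u (x ++ (y ++ x)) ⟧)
                ≡ k ^ j * (⟦ unbordered? x ⟧ * ⟦ isPrefix? u x ⟧)
    pointwise x refl = begin
      ⟦ unbordered? x ⟧ * ∑ (words k j) (λ y → ⟦ isPrefix? u (x ++ (y ++ x)) ⟧)
        ≡⟨ cong (⟦ unbordered? x ⟧ *_) (∑-cong (words k j) λ y →
             ⟦⟧-cong (isPrefix? u (x ++ (y ++ x))) (isPrefix? u x) (prefix-++ˡ u u≤i) (Prefix._++ᵖ (y ++ x))) ⟩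
      ⟦ unbordered? x ⟧ * ∑ (words k j) (λ _ → ⟦ isPrefix? u x ⟧)
        ≡⟨ cong (⟦ unbordered? x ⟧ *_) (∑-words-const j ⟦ isPrefix? u x ⟧) ⟩
      ⟦ unbordered? x ⟧ * (k ^ j * ⟦ isPrefix? u x ⟧)
        ≡⟨ x∙yz≈y∙xz *-commutativeSemigroup ⟦ unbordered? x ⟧ (k ^ j) ⟦ isPrefix? u x ⟧ ⟩
      k ^ j * (⟦ unbordered? x ⟧ * ⟦ isPrefix? u x ⟧) ∎

-- Arithmetic of differences and halves

m+n≡o⇒+m≡+o-+n : ∀ m n {o} → m + n ≡ o → + m ≡ + o ℤ.- + n
m+n≡o⇒+m≡+o-+n m n refl = sym (begin
  + (m + n) ℤ.- + n           ≡⟨ cong (ℤ._- + n) (ℤ.pos-+ m n) ⟩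
  (+ m ℤ.+ + n) ℤ.- + n       ≡⟨ ℤ.+-assoc (+ m) (+ n) (ℤ.- + n) ⟩
  + m ℤ.+ (+ n ℤ.- + n)       ≡⟨ cong (ℤ._+_ (+ m)) (ℤ.+-inverseʳ (+ n)) ⟩
  + m ℤ.+ ℤ.0ℤ                ≡⟨ ℤ.+-identityʳ (+ m) ⟩
  + m                         ∎)
  where open ≡-Reasoning

m≤⌊n/2⌋⇒m+m≤n : ∀ {m n} → m ≤ ⌊ n /2⌋ → m + m ≤ n
m≤⌊n/2⌋⇒m+m≤n {m} {n} le = subst (m + m ≤_) (⌊n/2⌋+⌈n/2⌉≡n n)
  (+-mono-≤ le (≤-trans le (⌊n/2⌋≤⌈n/2⌉ n)))

m+m≤n⇒m≤⌊n/2⌋ : ∀ m {n} → m + m ≤ n → m ≤ ⌊ n /2⌋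
m+m≤n⇒m≤⌊n/2⌋ m {n} le = subst (_≤ ⌊ n /2⌋) (sym (n≡⌊n+n/2⌋ m)) (⌊n/2⌋-mono le)

-- Brings n into the form required by the block decomposition x y x, with `n ∸ 2 * m` as the length
-- of y.
m+m≤n⇒n≡m+[n∸2*m+m] : ∀ m {n} → m + m ≤ n → n ≡ m + ((n ∸ 2 * m) + m)
m+m≤n⇒n≡m+[n∸2*m+m] m {n} le = begin
  n                       ≡⟨ m+[n∸m]≡n le ⟨
  (m + m) + (n ∸ (m + m)) ≡⟨ cong (λ x → (m + m) + (n ∸ (m + x))) (+-identityʳ m) ⟨
  (m + m) + (n ∸ 2 * m)   ≡⟨ +-assoc m m _ ⟩
  m + (m + (n ∸ 2 * m))   ≡⟨ cong (_+_ m) (+-comm m _) ⟩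
  m + ((n ∸ 2 * m) + m)   ∎
  where open ≡-Reasoning

-- The three regimes of the border length

module _ {k : ℕ} (u : Word k) {n : ℕ} (p≤n : length u ≤ n) where

  private
    p = length u
    q = n ∸ p

    p+q≡n : p + q ≡ n
    p+q≡n = m+[n∸m]≡n p≤n

  -- Exactly q letters follow u, so `i ≤ q` says that u ends before the second x begins.
  borderCount-≤ : ∀ {i} → i ≤ p → i ≤ q → borderCount u n i ≡ unborderedPrefixIndicator u i * k ^ (q ∸ i)
  borderCount-≤ {i} i≤p i≤q = trans
    (cong (λ m → borderCount u m i) n≡)
    (borderCount-disjoint u i (p ∸ i) (q ∸ i) (sym (m+[n∸m]≡n i≤p)))
    where
    rearrange : ∀ i d e → (i + d) + (i + e) ≡ i + ((d + e) + i)
    rearrange = solve-∀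
    n≡ : n ≡ i + (((p ∸ i) + (q ∸ i)) + i)
    n≡ = trans (sym p+q≡n) (trans (sym (cong₂ _+_ (m+[n∸m]≡n i≤p) (m+[n∸m]≡n i≤q))) (rearrange i (p ∸ i) (q ∸ i)))

  -- Only the last q letters of the second x lie beyond u, so the overlap has length `i ∸ q`.
  borderCount-> : ∀ {i} → q < i → i ≤ ⌊ n /2⌋ →
    borderCount u n i ≡ unborderedPrefixIndicator u i * borderIndicator u (i ∸ q)
  borderCount-> {i} q<i i≤ = trans
    (cong (λ m → borderCount u m i) n≡)
    (borderCount-overlap u i j (i ∸ q) p≡ (m<n⇒0<n∸m q<i) (m∸n≤m i q))
    where
    j = n ∸ 2 * i
    n≡ : n ≡ i + (j + i)
    n≡ = m+m≤n⇒n≡m+[n∸2*m+m] i (m≤⌊n/2⌋⇒m+m≤n i≤)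
    rearrange : ∀ i j q l → i + (j + (q + l)) ≡ (i + (j + l)) + q
    rearrange = solve-∀
    p≡ : p ≡ i + (j + (i ∸ q))
    -- Adding q to both sides turns `i ∸ q` back into i.
    p≡ = +-cancelʳ-≡ q p _ (begin
      p + q                   ≡⟨ p+q≡n ⟩
      n                       ≡⟨ n≡ ⟩
      i + (j + i)             ≡⟨ cong (λ x → i + (j + x)) (m+[n∸m]≡n (<⇒≤ q<i)) ⟨
      i + (j + (q + (i ∸ q))) ≡⟨ rearrange i j q (i ∸ q) ⟩
      (i + (j + (i ∸ q))) + q ∎)
      where open ≡-Reasoning

  borderCount-ℤ : ∀ {i} → p ≤ i → i ≤ ⌊ n /2⌋ →
    + borderCount u n i ≡ (+ (k ^ (i ∸ p)) ℤ.- + B k u i) ℤ.* + (k ^ (n ∸ 2 * i))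
  borderCount-ℤ {i} p≤i i≤ = begin
    + borderCount u n i
      ≡⟨ cong (λ m → + borderCount u m i) (m+m≤n⇒n≡m+[n∸2*m+m] i (m≤⌊n/2⌋⇒m+m≤n i≤)) ⟩
    + borderCount u (i + ((n ∸ 2 * i) + i)) i
      ≡⟨ cong +_ (borderCount-outside u (n ∸ 2 * i) p≤i) ⟩
    + (unborderedCount u i * k ^ (n ∸ 2 * i))
      ≡⟨ ℤ.pos-* (unborderedCount u i) (k ^ (n ∸ 2 * i)) ⟩
    + unborderedCount u i ℤ.* + (k ^ (n ∸ 2 * i))
      ≡⟨ cong (ℤ._* + (k ^ (n ∸ 2 * i))) (m+n≡o⇒+m≡+o-+n (unborderedCount u i) (B k u i)
           (subst (λ m → unborderedCount u m + B k u m ≡ k ^ (i ∸ p)) (m+[n∸m]≡n p≤i) (unborderedCount+B u (i ∸ p)))) ⟩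
    (+ (k ^ (i ∸ p)) ℤ.- + B k u i) ℤ.* + (k ^ (n ∸ 2 * i)) ∎
    where open ≡-Reasoning

theorem5 :
    (n p k : ℕ) → 1 ≤ p → p ≤ n → 2 ≤ k →
    (u : Word k) → length u ≡ p →
    let a = unborderedPrefixIndicator u
        b = borderIndicator u
    in
    (n ≤ 2 * p →
      B k u n ≡
        (Σℕ[ i from 1 to n ∸ p ] (a i * k ^ (n ∸ p ∸ i)))
        + (Σℕ[ i from n ∸ p + 1 to ⌊ n /2⌋ ] (a i * b (i ∸ (n ∸ p)))))
    ×
    (¬ (n ≤ 2 * p) →
      + B k u n ≡
        + (Σℕ[ i from 1 to p ] (a i * k ^ (n ∸ p ∸ i)))
        ℤ.+ (Σℤ[ i from p + 1 to ⌊ n /2⌋ ]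
              ((+ (k ^ (i ∸ p)) ℤ.- + B k u i) ℤ.* + (k ^ (n ∸ 2 * i)))))
theorem5 n p k _ p≤n _ u refl = short , long
  where
  q = n ∸ p

  2p≡p+p : 2 * p ≡ p + p
  2p≡p+p = cong (_+_ p) (+-identityʳ p)

  short : n ≤ 2 * p → _
  short n≤2p = trans (B-borderCount u n) (trans
    -- From n ≤ 2p follows q ≤ p and hence 2q ≤ n, so the cut at q, where the overlap starts, lies
    -- within the range.
    (Σℕ-split (borderCount u n) (m+m≤n⇒m≤⌊n/2⌋ q q+q≤n))
    (cong₂ _+_
      (Σℕ-cong 1 q λ i _ i≤q → borderCount-≤ u p≤n (≤-trans i≤q q≤p) i≤q)
      (Σℕ-cong (q + 1) ⌊ n /2⌋ λ i q<i i≤ → borderCount-> u p≤n (subst (_≤ i) (+-comm q 1) q<i) i≤)))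
    where
    q≤p : q ≤ p
    q≤p = m≤n+o⇒m∸n≤o n p (subst (n ≤_) 2p≡p+p n≤2p)
    q+q≤n : q + q ≤ n
    q+q≤n = subst (q + q ≤_) (m+[n∸m]≡n p≤n) (+-monoˡ-≤ q q≤p)

  long : ¬ (n ≤ 2 * p) → _
  long n≰2p = trans (cong +_ (trans (B-borderCount u n)
    -- Now 2p < n, and the cut is at p, beyond which x contains all of u.
    (Σℕ-split (borderCount u n) (m+m≤n⇒m≤⌊n/2⌋ p p+p≤n))))
    (trans (ℤ.pos-+ (Σℕ 1 p (borderCount u n)) _) (cong₂ ℤ._+_
      -- Since p ≤ q here, no length up to p produces an overlap.
      (cong +_ (Σℕ-cong 1 p λ i _ i≤p → borderCount-≤ u p≤n i≤p (≤-trans i≤p (m+n≤o⇒m≤o∸n p p+p≤n))))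
      (Σℕ⇒Σℤ (p + 1) ⌊ n /2⌋ λ i p<i i≤ → borderCount-ℤ u p≤n (m+n≤o⇒m≤o p p<i) i≤)))
    where
    p+p≤n : p + p ≤ n
    p+p≤n = subst (_≤ n) 2p≡p+p (<⇒≤ (≰⇒> n≰2p))
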